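{- For all integers $k\geq 3$ and $\ell\in \mathbb{N}$, and all sufficiently large $n$, \[ \operatorname{sat}_k(n,\text{Berge- }K_{1,\ell})=\min_{a\in[n],\ \binom{a-1}{k-1}\leq \ell-2} \left(\left\lceil\frac{(\ell-1)(n-a)}k\right\rceil+\binom{a}k\right). \]
   Context: $[n]=\{1,\dots,n\}$, and $K_{1,\ell}$ is the star with one center and $\ell$ leaves. A $k$-uniform hypergraph $H$ has edges that are $k$-element subsets of $V(H)$ (no repeated edges). Given a graph $G$, a $k$-uniform hypergraph $H$ contains a Berge-$G$ if there is an injection $\phi:E(G)\to E(H)$, with $G$ embedded on vertices of $H$, such that $e\subseteq \phi(e)$ for every $e\in E(G)$. A $k$-uniform hypergraph $H$ is Berge-$G$-saturated if $H$ contains no Berge-$G$, but for every $k$-subset $e$ of $V(H)$ with $e\notin E(H)$, the hypergraph $H+e$ contains a Berge-$G$. The saturation number $\operatorname{sat}_k(n,\text{Berge- }G)$ is the minimum number of edges of a Berge-$G$-saturated $k$-uniform hypergraph on $n$ vertices.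
   Formalization: The formal statement assumes ℓ ≥ 2: for ℓ ≤ 1 the condition C(a−1,k−1) ≤ ℓ−2 < 0 is satisfied by no a, so the minimum on the right-hand side is over the empty set and undefined. -}

module Defs where

open import Data.Nat using (ℕ; zero; suc; _+_; _*_; _∸_; _≤_; _/_)
open import Data.Nat.Combinatorics using (_C_)
open import Data.Fin using (Fin; zero; suc)
open import Data.Fin.Subset using (Subset; ∣_∣) renaming (_∈_ to _∈ₛ_)
open import Data.List using (List; length; lookup; _∷_)
open import Data.List.Membership.Propositional using () renaming (_∈_ to _∈ₗ_)
open import Data.List.Relation.Unary.All using (All)
open import Data.List.Relation.Unary.Unique.Propositional using (Unique)
open import Data.Product using (Σ; ∃; _×_; _,_)
open import Relation.Binary.PropositionalEquality using (_≡_)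
open import Relation.Nullary using (¬_)
open import Function.Definitions using (Injective)

record Graph : Set where
  field
    nv    : ℕ
    edges : List (Fin nv × Fin nv)
open Graph public

star : ℕ → Graph
star ℓ = record { nv = suc ℓ ; edges = Data.List.map (λ i → (zero , suc i)) (Data.List.allFin ℓ) }
  where import Data.List

Hypergraph : ℕ → Set
Hypergraph n = List (Subset n)

IsUniform : ∀ {n} → ℕ → Hypergraph n → Set
IsUniform k H = Unique H × All (λ e → ∣ e ∣ ≡ k) H

ContainsBerge : ∀ {n} → Graph → Hypergraph n → Set
ContainsBerge {n} G H =
  Σ (Fin (nv G) → Fin n) λ ψ →
  Σ (Fin (length (edges G)) → Fin (length H)) λ φ →
    Injective _≡_ _≡_ ψ × Injective _≡_ _≡_ φ ×
    (∀ j → let uv = lookup (edges G) j in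
           (ψ (Data.Product.proj₁ uv) ∈ₛ lookup H (φ j)) ×
           (ψ (Data.Product.proj₂ uv) ∈ₛ lookup H (φ j)))
  where import Data.Product

IsBergeSaturated : ∀ {n} → ℕ → Graph → Hypergraph n → Set
IsBergeSaturated {n} k G H =
  IsUniform k H × ¬ ContainsBerge G H ×
  (∀ (e : Subset n) → ∣ e ∣ ≡ k → ¬ (e ∈ₗ H) → ContainsBerge G (e ∷ H))

IsSatNumber : ℕ → ℕ → Graph → ℕ → Set
IsSatNumber k n G s =
  (Σ (Hypergraph n) λ H → IsBergeSaturated k G H × length H ≡ s) ×
  (∀ (H : Hypergraph n) → IsBergeSaturated k G H → s ≤ length H)

-- Ceiling division ⌈ m / k ⌉ (k = 0 case irrelevant, returns 0).
ceilDiv : ℕ → ℕ → ℕ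
ceilDiv m zero    = 0
ceilDiv m (suc j) = (m + j) / suc j

rhsTerm : ℕ → ℕ → ℕ → ℕ → ℕ
rhsTerm k ℓ n a = ceilDiv ((ℓ ∸ 1) * (n ∸ a)) k + a C k

Admissible : ℕ → ℕ → ℕ → ℕ → Set
Admissible k ℓ n a = 1 ≤ a × a ≤ n × (a ∸ 1) C (k ∸ 1) ≤ ℓ ∸ 2

IsMinRHS : ℕ → ℕ → ℕ → ℕ → Set
IsMinRHS k ℓ n m =
  (∃ λ a → Admissible k ℓ n a × rhsTerm k ℓ n a ≡ m) ×
  (∀ a → Admissible k ℓ n a → m ≤ rhsTerm k ℓ n a)

{-# OPTIONS --safe #-}
-- Put d = ℓ − 1.
--
-- Lower bound.  Let A be the set of vertices of degree < d in a saturated H.  A new edge must contain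
-- the centre of the star that it completes, and that centre has degree ≥ d; so every k-subset of A is
-- already an edge.  This makes a = |A| admissible, and the edges not inside A are counted by the
-- degrees of the n − a vertices outside A.
--
-- Upper bound.  Take the complete k-uniform hypergraph on a vertex set A together with
-- q = ⌈d(n − a)/k⌉ blocks, any two sharing at most one vertex, in which every vertex outside A has
-- degree d and r = qk − d(n − a) < k vertices of A have degree 1.  No degree exceeds d.  A new edge e
-- contains some v ∉ A; as the blocks through v are disjoint apart from v and have k − 1 ≥ 2 further
-- vertices, they have distinct representatives that also avoid a chosen vertex of e ∖ {v}.
--
-- The blocks are filled one incidence at a time.  If v lacks degree and block e lacks a vertex, pick
-- an incidence x ∈ g far from both, and replace it by v ∈ g and x ∈ e: linearity survives.  Only
-- boundedly many blocks are close, so for large n one exists unless almost nothing has been filled,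
-- and then an unused vertex can be put in an empty block.
module Submission where

open import Defs
open import Data.Bool using (Bool; true; false; not)
import Data.Bool.Properties as Bool
open import Data.Empty using (⊥; ⊥-elim)
open import Data.Fin using (Fin; zero; suc; cast)
import Data.Fin as Fin
import Data.Fin.Properties as Fin
open import Data.Fin.Subset using (Subset; inside; outside; ∣_∣; ∁; _⊆_) renaming (_∈_ to _∈ₛ_; _∉_ to _∉ₛ_)
open import Data.Fin.Subset.Properties using (_∈?_; drop-∷-⊆; out⊆; in⊆in; nonempty?; x∈∁p⇒x∉p; ∣∁p∣≡n∸∣p∣; ∣p∣≤n)
open import Data.List using (List; []; _∷_; _++_; length; filter; concatMap; allFin; tabulate; map; lookup)
open import Data.List.Membership.Propositional using (_∈_; _∉_)
open import Data.List.Membership.Propositional.Properties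
open import Data.List.Properties using (length-++; length-tabulate; length-map; map-++; map-∘; tabulate-lookup)
open import Data.List.Relation.Binary.Permutation.Propositional using (_↭_; ↭-refl; ↭-trans; prep)
open import Data.List.Relation.Binary.Permutation.Propositional.Properties using (shift; ↭-length; map⁺; All-resp-↭)
open import Data.List.Relation.Unary.All using (All; []; _∷_)
import Data.List.Relation.Unary.All as All
import Data.List.Relation.Unary.All.Properties as All
open import Data.List.Relation.Unary.Any using (here; there)
import Data.List.Relation.Unary.Any as Any
import Data.List.Relation.Unary.Any.Properties as Any using (lookup-index)
open import Data.List.Relation.Unary.Unique.Propositional using (Unique; []; _∷_)
import Data.List.Relation.Unary.Unique.Propositional.Properties as Unique
open import Data.Nat using (ℕ; zero; suc; _+_; _*_; _∸_; _≤_; _<_; z≤n; s≤s; _≤?_; _<?_; _/_; _%_; _≤ᵇ_; _<ᵇ_)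
open import Data.Nat.Combinatorics using (_C_; k>n⇒nCk≡0; nCk+nC[k+1]≡[n+1]C[k+1])
open import Data.Nat.DivMod using (m<n*o⇒m/o<n; m≡m%n+[m/n]*n; m%n<n; /-monoˡ-≤)
import Data.Nat.ListAction as ℕ
import Data.Nat.ListAction.Properties as ℕ
open import Data.Nat.Properties
open import Data.Product using (Σ; ∃; _×_; _,_; proj₁; proj₂)
open import Data.Sum using (_⊎_; inj₁; inj₂)
import Data.Vec as Vec
open import Data.Vec using ([]; _∷_; here; there)
open import Data.Vec.Properties using ([]=⇒lookup; lookup⇒[]=; lookup∘tabulate; ≡-dec)
import Data.Vec.Properties as Vec
open import Function using (_∘_; flip; id; Equivalence)
open import Function.Definitions using (Injective)
open import Relation.Binary.PropositionalEquality
open import Relation.Nullary using (¬_; Dec; yes; no; contradiction; ¬?; _×-dec_)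

open import Algebra.Properties.CommutativeMonoid.Sum +-0-commutativeMonoid using (sum; sum-cong-≗; ∑-distrib-+; ∑-comm)

private
  variable
    n q k ℓ : ℕ

-- Sums and cardinalities over `Fin n`

⟦_⟧ : Bool → ℕ
⟦ true ⟧ = 1
⟦ false ⟧ = 0

sum-const : ∀ n c → sum {n} (λ _ → c) ≡ n * c
sum-const zero c = refl
sum-const (suc n) c = cong (c +_) (sum-const n c)

sum-*ˡ : ∀ c (f : Fin n → ℕ) → sum (λ i → c * f i) ≡ c * sum f
sum-*ˡ {zero} c f = sym (*-zeroʳ c)
sum-*ˡ {suc n} c f = trans (cong (c * f zero +_) (sum-*ˡ c (f ∘ suc))) (sym (*-distribˡ-+ c (f zero) _))

sum-mono-≤ : {f g : Fin n → ℕ} → (∀ i → f i ≤ g i) → sum f ≤ sum g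
sum-mono-≤ {zero} h = z≤n
sum-mono-≤ {suc n} h = +-mono-≤ (h zero) (sum-mono-≤ (h ∘ suc))

sum-mono-< : {f g : Fin n → ℕ} → (∀ i → f i ≤ g i) → ∀ i → f i < g i → sum f < sum g
sum-mono-< h zero lt = +-mono-<-≤ lt (sum-mono-≤ (h ∘ suc))
sum-mono-< h (suc i) lt = +-mono-≤-< (h zero) (sum-mono-< (h ∘ suc) i lt)

sum-<⇒∃< : {f g : Fin n → ℕ} → sum f < sum g → ∃ λ i → f i < g i
sum-<⇒∃< {n} {f} {g} lt with Fin.any? (λ i → f i <? g i)
... | yes p = p
... | no ¬p = contradiction lt (≤⇒≯ (sum-mono-≤ λ i → ≮⇒≥ λ p → ¬p (i , p)))

≤∧sum≡⇒≗ : {f g : Fin n → ℕ} → (∀ i → f i ≤ g i) → sum f ≡ sum g → ∀ i → f i ≡ g i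
≤∧sum≡⇒≗ {f = f} {g} h eq i with f i <? g i
... | yes lt = contradiction eq (<⇒≢ (sum-mono-< h i lt))
... | no ≮ = ≤-antisym (h i) (≮⇒≥ ≮)

sum-bump : {f f′ : Fin n → ℕ} (i : Fin n) → f′ i ≡ suc (f i) →
           (∀ j → j ≢ i → f′ j ≡ f j) → sum f′ ≡ suc (sum f)
sum-bump zero eq h = cong₂ _+_ eq (sum-cong-≗ λ j → h (suc j) λ ())
sum-bump {f = f} (suc i) eq h = trans
  (cong₂ _+_ (h zero λ ()) (sum-bump i eq λ j j≢i → h (suc j) (j≢i ∘ Fin.suc-injective)))
  (+-suc (f zero) _)

card : (Fin n → Bool) → ℕ
card p = sum (λ i → ⟦ p i ⟧)

card≡0 : {p : Fin n → Bool} → (∀ i → p i ≢ true) → card p ≡ 0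
card≡0 {n} {p} h = trans (sum-cong-≗ λ i → cong ⟦_⟧ (Bool.¬-not (h i))) (trans (sum-const n 0) (*-zeroʳ n))

card-mono : {p p′ : Fin n → Bool} → (∀ i → p i ≡ true → p′ i ≡ true) → card p ≤ card p′
card-mono {p = p} {p′} h = sum-mono-≤ (λ i → go (p i) (p′ i) (h i))
  where
  go : ∀ x y → (x ≡ true → y ≡ true) → ⟦ x ⟧ ≤ ⟦ y ⟧
  go false y h = z≤n
  go true y h rewrite h refl = ≤-refl

-- Finite sets as lists, and the pigeonhole principle

members : (Fin n → Bool) → List (Fin n)
members p = filter (λ i → p i Bool.≟ true) (allFin _)

∈-members⁺ : ∀ (p : Fin n → Bool) {i} → p i ≡ true → i ∈ members p
∈-members⁺ p eq = ∈-filter⁺ (λ _ → _ Bool.≟ _) (∈-allFin _) eq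

∈-members⁻ : ∀ {p : Fin n → Bool} {i} → i ∈ members p → p i ≡ true
∈-members⁻ {p = p} i∈ = proj₂ (∈-filter⁻ (λ i → p i Bool.≟ true) {xs = allFin _} i∈)

members-unique : (p : Fin n → Bool) → Unique (members p)
members-unique p = Unique.filter⁺ (λ i → p i Bool.≟ true) (Unique.allFin⁺ _)

length-members : (p : Fin n → Bool) → length (members p) ≡ card p
length-members p = go (λ i → i)
  where
  go : ∀ {m} (f : Fin m → Fin _) → length (filter (λ i → p i Bool.≟ true) (tabulate f)) ≡ card (p ∘ f)
  go {zero} f = refl
  go {suc m} f with p (f zero)
  ... | true = cong suc (go (f ∘ suc))
  ... | false = go (f ∘ suc)

-- Each `x` is cut out of `ys` where it occurs; by uniqueness the later elements of `xs` survive the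
-- cut. It serves to split a saturated hypergraph into the edges inside `A` and the rest.
⊆⇒↭++ : ∀ {A : Set} {xs ys : List A} → Unique xs → (∀ {x} → x ∈ xs → x ∈ ys) →
        ∃ λ zs → ys ↭ xs ++ zs
⊆⇒↭++ {xs = []} {ys} u h = ys , ↭-refl
⊆⇒↭++ {xs = x ∷ xs} u@(_ ∷ u′) h with ∈-∃++ (h (here refl))
... | as , bs , refl with ⊆⇒↭++ u′ inRest
  where
  inRest : ∀ {y} → y ∈ xs → y ∈ as ++ bs
  inRest y∈ with ∈-++⁻ as (h (there y∈))
  ... | inj₁ y∈as = ∈-++⁺ˡ y∈as
  ... | inj₂ (here refl) = contradiction y∈ (Unique.Unique[x∷xs]⇒x∉xs u)
  ... | inj₂ (there y∈bs) = ∈-++⁺ʳ as y∈bs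
... | zs , p = zs , ↭-trans (shift x as bs) (prep x p)

length-⊆ : ∀ {A : Set} {xs ys : List A} → Unique xs → (∀ {x} → x ∈ xs → x ∈ ys) → length xs ≤ length ys
length-⊆ {xs = xs} {ys} u h with ⊆⇒↭++ u h
... | zs , p = begin
  length xs             ≤⟨ m≤m+n _ _ ⟩
  length xs + length zs ≡⟨ length-++ xs ⟨
  length (xs ++ zs)     ≡⟨ ↭-length p ⟨
  length ys             ∎
  where open ≤-Reasoning

-- Otherwise the duplicate-free list `members p` would embed in the shorter list `xs`.
∃∈∉ : (p : Fin n → Bool) (xs : List (Fin n)) → length xs < card p → ∃ λ i → p i ≡ true × i ∉ xs
∃∈∉ {n} p xs lt with Fin.any? (λ i → (p i Bool.≟ true) ×-dec ¬? (Any.any? (i Fin.≟_) xs))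
... | yes r = r
... | no ¬r = contradiction lt (≤⇒≯ (subst (_≤ length xs) (length-members p) (length-⊆ (members-unique p) inXs)))
  where
  inXs : ∀ {i} → i ∈ members p → i ∈ xs
  inXs {i} i∈ with Any.any? (i Fin.≟_) xs
  ... | yes i∈xs = i∈xs
  ... | no i∉xs = contradiction (i , ∈-members⁻ i∈ , i∉xs) ¬r

∃∉ : (xs : List (Fin n)) → length xs < n → ∃ λ i → i ∉ xs
∃∉ {n} xs lt with ∃∈∉ (λ _ → true) xs (subst (length xs <_) (sym (trans (sum-const n 1) (*-identityʳ n))) lt)
... | i , _ , i∉ = i , i∉

length-concatMap-≤ : ∀ {A B : Set} {c} (f : A → List B) → (∀ x → length (f x) ≤ c) →
                     ∀ xs → length (concatMap f xs) ≤ length xs * c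
length-concatMap-≤ f h [] = z≤n
length-concatMap-≤ f h (x ∷ xs) = ≤-trans (≤-reflexive (length-++ (f x)))
  (+-mono-≤ (h x) (length-concatMap-≤ f h xs))

∈-concatMap : ∀ {A B : Set} (f : A → List B) {xs x y} → x ∈ xs → y ∈ f x → y ∈ concatMap f xs
∈-concatMap f x∈ y∈ = ∈-concatMap⁺ f (Any.map (λ { refl → y∈ }) x∈)

-- Incidences between vertices and blocks

Incidence : ℕ → ℕ → Set
Incidence n q = Fin n → Fin q → Bool

-- Equivalently, the bipartite incidence graph has no 4-cycle, a condition symmetric in vertices and
-- blocks.
Linear : Incidence n q → Set
Linear I = ∀ {v w e f} → v ≢ w → e ≢ f →
  I v e ≡ true → I v f ≡ true → I w e ≡ true → I w f ≡ true → ⊥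

degree : Incidence n q → Fin n → ℕ
degree I v = card (I v)

size : Incidence n q → Fin q → ℕ
size I e = card (flip I e)

total : Incidence n q → ℕ
total I = sum (degree I)

total≡sum-size : (I : Incidence n q) → total I ≡ sum (size I)
total≡sum-size I = ∑-comm (λ v e → ⟦ I v e ⟧)

-- A relation rather than a function, so that the deletion of an incidence is the same relation read
-- from `J` to `I` and one set of lemmas serves both.
record Adds (x : Fin n) (g : Fin q) (I J : Incidence n q) : Set where
  field
    old : I x g ≡ false
    new : J x g ≡ true
    same : ∀ v e → v ≢ x ⊎ e ≢ g → J v e ≡ I v e

module _ {x : Fin n} {g : Fin q} {I J : Incidence n q} (a : Adds x g I J) where
  open Adds a

  degree-here : degree J x ≡ suc (degree I x)
  degree-here = sum-bump g (trans (cong ⟦_⟧ new) (cong (suc ∘ ⟦_⟧) (sym old)))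
    λ e e≢g → cong ⟦_⟧ (same x e (inj₂ e≢g))

  degree-there : ∀ {v} → v ≢ x → degree J v ≡ degree I v
  degree-there v≢x = sum-cong-≗ λ e → cong ⟦_⟧ (same _ e (inj₁ v≢x))

  size-here : size J g ≡ suc (size I g)
  size-here = sum-bump x (trans (cong ⟦_⟧ new) (cong (suc ∘ ⟦_⟧) (sym old)))
    λ v v≢x → cong ⟦_⟧ (same v g (inj₁ v≢x))

  size-there : ∀ {e} → e ≢ g → size J e ≡ size I e
  size-there e≢g = sum-cong-≗ λ v → cong ⟦_⟧ (same v _ (inj₂ e≢g))

  total-suc : total J ≡ suc (total I)
  total-suc = sum-bump x degree-here λ _ → degree-there

  Adds-cases : ∀ {v e} → J v e ≡ true → (v ≡ x × e ≡ g) ⊎ I v e ≡ true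
  Adds-cases {v} {e} p with v Fin.≟ x | e Fin.≟ g
  ... | yes v≡x | yes e≡g = inj₁ (v≡x , e≡g)
  ... | no v≢x  | _       = inj₂ (trans (sym (same v e (inj₁ v≢x))) p)
  ... | yes _   | no e≢g  = inj₂ (trans (sym (same v e (inj₂ e≢g))) p)

  Adds-⊆ : ∀ {v e} → I v e ≡ true → J v e ≡ true
  Adds-⊆ {v} {e} p with v Fin.≟ x | e Fin.≟ g
  ... | yes refl | yes refl = new
  ... | no v≢x  | _       = trans (same v e (inj₁ v≢x)) p
  ... | yes _   | no e≢g  = trans (same v e (inj₂ e≢g)) p

  -- A new 4-cycle must use the added incidence, so it consists of `x`, `g`, another vertex `w` of
  -- `g` and another block `h` through both `x` and `w`.
  Linear-add : Linear I →
    (∀ {w h} → w ≢ x → h ≢ g → I w g ≡ true → I w h ≡ true → I x h ≡ true → ⊥) → Linear J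
  Linear-add lin fresh {v} {w} {e} {f} v≢w e≢f ve vf we wf
    with Adds-cases ve | Adds-cases vf | Adds-cases we | Adds-cases wf
  ... | inj₂ ve′ | inj₂ vf′ | inj₂ we′ | inj₂ wf′ = lin v≢w e≢f ve′ vf′ we′ wf′
  ... | inj₁ (refl , refl) | inj₂ vf′ | inj₂ we′ | inj₂ wf′ = fresh (v≢w ∘ sym) (e≢f ∘ sym) we′ wf′ vf′
  ... | inj₂ ve′ | inj₁ (refl , refl) | inj₂ we′ | inj₂ wf′ = fresh (v≢w ∘ sym) e≢f wf′ we′ ve′
  ... | inj₂ ve′ | inj₂ vf′ | inj₁ (refl , refl) | inj₂ wf′ = fresh v≢w (e≢f ∘ sym) ve′ vf′ wf′
  ... | inj₂ ve′ | inj₂ vf′ | inj₂ we′ | inj₁ (refl , refl) = fresh v≢w e≢f vf′ ve′ we′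
  -- If two corners of the 4-cycle are the added incidence, its two vertices or its two blocks
  -- coincide.
  ... | inj₁ (refl , refl) | inj₁ (_ , refl) | _ | _ = e≢f refl
  ... | inj₁ (refl , refl) | _ | inj₁ (refl , _) | _ = v≢w refl
  ... | inj₁ (refl , refl) | _ | _ | inj₁ (refl , _) = v≢w refl
  ... | _ | inj₁ (refl , refl) | inj₁ (refl , _) | _ = v≢w refl
  ... | _ | inj₁ (refl , refl) | _ | inj₁ (refl , _) = v≢w refl
  ... | _ | _ | inj₁ (refl , refl) | inj₁ (_ , refl) = e≢f refl

Linear-⊆ : {I J : Incidence n q} → (∀ {v e} → I v e ≡ true → J v e ≡ true) → Linear J → Linear I
Linear-⊆ h lin v≢w e≢f a b c d = lin v≢w e≢f (h a) (h b) (h c) (h d)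

-- Abstract, so that splitting on v ≟ x in a later proof does not also unfold set in the goal.
abstract
  set : Fin n → Fin q → Bool → Incidence n q → Incidence n q
  set x g b I v e with v Fin.≟ x | e Fin.≟ g
  ... | yes _ | yes _ = b
  ... | _     | _     = I v e

  set-here : ∀ (x : Fin n) (g : Fin q) {b} I → set x g b I x g ≡ b
  set-here x g I with x Fin.≟ x | g Fin.≟ g
  ... | yes _ | yes _ = refl
  ... | no ¬p | _ = contradiction refl ¬p
  ... | yes _ | no ¬p = contradiction refl ¬p

  set-there : ∀ {x : Fin n} {g : Fin q} {b} {I} v e → v ≢ x ⊎ e ≢ g → set x g b I v e ≡ I v e
  set-there {x = x} {g} v e h with v Fin.≟ x | e Fin.≟ g | h
  ... | yes p | yes _ | inj₁ ¬p = contradiction p ¬p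
  ... | yes _ | yes p | inj₂ ¬p = contradiction p ¬p
  ... | yes _ | no _ | _ = refl
  ... | no _ | _ | _ = refl

Adds-set-true : ∀ {x : Fin n} {g : Fin q} {I} → I x g ≡ false → Adds x g I (set x g true I)
Adds-set-true {x = x} {g} {I} p = record { old = p ; new = set-here x g I ; same = set-there }

Adds-set-false : ∀ {x : Fin n} {g : Fin q} {I} → I x g ≡ true → Adds x g (set x g false I) I
Adds-set-false {x = x} {g} {I} p = record
  { old = set-here x g I ; new = p ; same = λ v e h → sym (set-there v e h) }

-- Linear designs with prescribed degrees

-- The factors count a walk: at most `suc k` starting vertices, `d` blocks through each, `k`
-- vertices in each of these, and `d` blocks through each again.
reach : ℕ → ℕ → ℕ
reach k d = suc k * d * k * d

module _ {n q : ℕ} (k d : ℕ) (t : Fin n → ℕ) where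

  record Partial (I : Incidence n q) : Set where
    field
      linear   : Linear I
      degree≤t : ∀ v → degree I v ≤ t v
      size≤k   : ∀ e → size I e ≤ k

  module Swap {I : Incidence n q} (P : Partial I)
    {v : Fin n} (v<t : degree I v < t v) {e : Fin q} (e<k : size I e < k)
    {x : Fin n} {g : Fin q} (x∈g : I x g ≡ true)
    -- Taking f = g shows that g is disjoint from e and does not contain v.
    (far : ∀ {u f w} → u ≡ v ⊎ I u e ≡ true → I u f ≡ true → I w f ≡ true → I w g ≢ true)
    where
    open Partial P

    v∉g : I v g ≢ true
    v∉g p = far (inj₁ refl) p p p

    x∉e : I x e ≢ true
    x∉e p = far (inj₂ p) x∈g x∈g x∈g

    v≢x : v ≢ x
    v≢x refl = v∉g x∈g

    e≢g : e ≢ g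
    e≢g refl = x∉e x∈g

    -- Take `x` out of `g`, put `v` into `g`, then put `x` into `e`. On balance only `v` gains
    -- degree and only `e` gains size.
    J₀ J₁ J₂ : Incidence n q
    J₀ = set x g false I
    J₁ = set v g true J₀
    J₂ = set x e true J₁

    a₀ : Adds x g J₀ I
    a₀ = Adds-set-false x∈g

    a₁ : Adds v g J₀ J₁
    a₁ = Adds-set-true (trans (set-there v g (inj₁ v≢x)) (Bool.¬-not v∉g))

    a₂ : Adds x e J₁ J₂
    a₂ = Adds-set-true (trans (set-there x e (inj₁ (v≢x ∘ sym)))
           (trans (set-there x e (inj₂ e≢g)) (Bool.¬-not x∉e)))

    J₁⊆I : ∀ {w h} → w ≢ v ⊎ h ≢ g → J₁ w h ≡ true → I w h ≡ true
    J₁⊆I out p with Adds-cases a₁ p | out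
    ... | inj₂ p′ | _ = Adds-⊆ a₀ p′
    ... | inj₁ (eq , _) | inj₁ neq = contradiction eq neq
    ... | inj₁ (_ , eq) | inj₂ neq = contradiction eq neq

    J₁-x : ∀ {h} → J₁ x h ≡ true → h ≢ g
    J₁-x p refl with Adds-cases a₁ p
    ... | inj₁ (eq , _) = v≢x (sym eq)
    ... | inj₂ p′ with trans (sym p′) (Adds.old a₀)
    ...   | ()

    -- A 4-cycle through `v` and `g` would lead from `v` by one block to a vertex of `g`; one
    -- through `x` and `e` would lead from a vertex of `e` by one block to `x`, which lies in `g` in
    -- `I`. Both contradict `far`.
    linear₂ : Linear J₂
    linear₂ = Linear-add a₂ (Linear-add a₁ (Linear-⊆ (Adds-⊆ a₀) linear)
      (λ _ _ wg wh vh → far (inj₁ refl) (Adds-⊆ a₀ vh) (Adds-⊆ a₀ wh) (Adds-⊆ a₀ wg)))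
      (λ _ _ we wh xh → let h≢g = J₁-x xh in
        far (inj₂ (J₁⊆I (inj₂ e≢g) we)) (J₁⊆I (inj₂ h≢g) wh) (J₁⊆I (inj₂ h≢g) xh) x∈g)

    degree₂ : ∀ w → degree J₂ w ≤ t w
    degree₂ w with w Fin.≟ x
    ... | yes refl = begin
      degree J₂ x       ≡⟨ degree-here a₂ ⟩
      suc (degree J₁ x) ≡⟨ cong suc (degree-there a₁ (v≢x ∘ sym)) ⟩
      suc (degree J₀ x) ≡⟨ degree-here a₀ ⟨
      degree I x        ≤⟨ degree≤t x ⟩
      t x               ∎
      where open ≤-Reasoning
    ... | no w≢x with w Fin.≟ v
    ...   | yes refl = begin
      degree J₂ v       ≡⟨ degree-there a₂ w≢x ⟩
      degree J₁ v       ≡⟨ degree-here a₁ ⟩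
      suc (degree J₀ v) ≡⟨ cong suc (degree-there a₀ w≢x) ⟨
      suc (degree I v)  ≤⟨ v<t ⟩
      t v               ∎
      where open ≤-Reasoning
    ...   | no w≢v = begin
      degree J₂ w       ≡⟨ degree-there a₂ w≢x ⟩
      degree J₁ w       ≡⟨ degree-there a₁ w≢v ⟩
      degree J₀ w       ≡⟨ degree-there a₀ w≢x ⟨
      degree I w        ≤⟨ degree≤t w ⟩
      t w               ∎
      where open ≤-Reasoning

    size₂ : ∀ h → size J₂ h ≤ k
    size₂ h with h Fin.≟ g
    ... | yes refl = begin
      size J₂ g       ≡⟨ size-there a₂ (e≢g ∘ sym) ⟩
      size J₁ g       ≡⟨ size-here a₁ ⟩
      suc (size J₀ g) ≡⟨ size-here a₀ ⟨
      size I g        ≤⟨ size≤k g ⟩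
      k               ∎
      where open ≤-Reasoning
    ... | no h≢g with h Fin.≟ e
    ...   | yes refl = begin
      size J₂ e       ≡⟨ size-here a₂ ⟩
      suc (size J₁ e) ≡⟨ cong suc (size-there a₁ h≢g) ⟩
      suc (size J₀ e) ≡⟨ cong suc (size-there a₀ h≢g) ⟨
      suc (size I e)  ≤⟨ e<k ⟩
      k               ∎
      where open ≤-Reasoning
    ...   | no h≢e = begin
      size J₂ h       ≡⟨ size-there a₂ h≢e ⟩
      size J₁ h       ≡⟨ size-there a₁ h≢g ⟩
      size J₀ h       ≡⟨ size-there a₀ h≢g ⟨
      size I h        ≤⟨ size≤k h ⟩
      k               ∎
      where open ≤-Reasoning

    swap : ∃ λ J → Partial J × total J ≡ suc (total I)
    swap = J₂ , record { linear = linear₂ ; degree≤t = degree₂ ; size≤k = size₂ }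
         , trans (total-suc a₂) (cong suc (trans (total-suc a₁) (sym (total-suc a₀))))

  -- For the case in which there is no far incidence at hand to swap. No 4-cycle arises, as `g` has
  -- no other vertex.
  place : ∀ {I : Incidence n q} → Partial I → ∀ {x g} → 1 ≤ t x → 1 ≤ k →
          (∀ e → I x e ≢ true) → (∀ v → I v g ≢ true) →
          ∃ λ J → Partial J × total J ≡ suc (total I)
  place {I} P {x} {g} 1≤t 1≤k x∉ g∌ =
    set x g true I , record { linear = Linear-add a linear (λ _ _ wg _ _ → g∌ _ wg) ; degree≤t = degree′ ; size≤k = size′ }
    , total-suc a
    where
    open Partial P
    a : Adds x g I (set x g true I)
    a = Adds-set-true (Bool.¬-not (x∉ g))
    degree′ : ∀ w → degree (set x g true I) w ≤ t w
    degree′ w with w Fin.≟ x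
    ... | yes refl = subst (_≤ t x) (sym (trans (degree-here a) (cong suc (card≡0 x∉)))) 1≤t
    ... | no w≢x = subst (_≤ t w) (sym (degree-there a w≢x)) (degree≤t w)
    size′ : ∀ h → size (set x g true I) h ≤ k
    size′ h with h Fin.≟ g
    ... | yes refl = subst (_≤ k) (sym (trans (size-here a) (cong suc (card≡0 g∌)))) 1≤k
    ... | no h≢g = subst (_≤ k) (sym (size-there a h≢g)) (size≤k h)

  -- `Z` holds the vertices whose prescribed degree may be 0, which `place` has to avoid. By `∑t`
  -- the prescribed degrees fill `q` blocks of size `k` exactly.
  module _ (1≤k : 1 ≤ k) (t≤d : ∀ v → t v ≤ d) (Z : List (Fin n)) (1≤t : ∀ {v} → v ∉ Z → 1 ≤ t v)
    (∑t : sum t ≡ q * k) (reach<q : reach k d < q) (reach<n : reach k d * k + length Z < n) where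

    -- A deficit in the total leaves some vertex short of degree and, by double counting, some block
    -- short of vertices.
    augment : ∀ {I : Incidence n q} → Partial I → total I < sum t →
              ∃ λ J → Partial J × total J ≡ suc (total I)
    augment {I} P lt = go
      where
      open Partial P
      E : Fin n → List (Fin q)
      E u = members (I u)
      V : Fin q → List (Fin n)
      V f = members (flip I f)
      |E|≤d : ∀ u → length (E u) ≤ d
      |E|≤d u = ≤-trans (≤-reflexive (length-members (I u))) (≤-trans (degree≤t u) (t≤d u))
      |V|≤k : ∀ f → length (V f) ≤ k
      |V|≤k f = ≤-trans (≤-reflexive (length-members (flip I f))) (size≤k f)

      ∃v : ∃ λ v → degree I v < t v
      ∃v = sum-<⇒∃< lt
      ∃e : ∃ λ e → size I e < k
      ∃e = sum-<⇒∃< (subst₂ _<_ (total≡sum-size I) (trans ∑t (sym (sum-const q k))) lt)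
      v = proj₁ ∃v
      e = proj₁ ∃e

      -- L₃ lists the blocks for which the hypothesis far of Swap fails, and L₄ their vertices.
      L₀ L₂ L₄ : List (Fin n)
      L₁ L₃ : List (Fin q)
      L₀ = v ∷ V e
      L₁ = concatMap E L₀
      L₂ = concatMap V L₁
      L₃ = concatMap E L₂
      L₄ = concatMap V L₃

      |L₃| : length L₃ ≤ reach k d
      |L₃| = ≤-trans (length-concatMap-≤ E |E|≤d L₂) (*-monoˡ-≤ d
            (≤-trans (length-concatMap-≤ V |V|≤k L₁) (*-monoˡ-≤ k
            (≤-trans (length-concatMap-≤ E |E|≤d L₀) (*-monoˡ-≤ d (s≤s (|V|≤k e)))))))

      |L₄++Z| : length (L₄ ++ Z) ≤ reach k d * k + length Z
      |L₄++Z| = ≤-trans (≤-reflexive (length-++ L₄)) (+-monoˡ-≤ (length Z)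
        (≤-trans (length-concatMap-≤ V |V|≤k L₃) (*-monoˡ-≤ k |L₃|)))

      ∉L₃⇒far : ∀ {g} → g ∉ L₃ → ∀ {u f w} → u ≡ v ⊎ I u e ≡ true → I u f ≡ true → I w f ≡ true → I w g ≢ true
      ∉L₃⇒far g∉ {u} {f} {w} u∈ uf wf wg = g∉
        (∈-concatMap E (∈-concatMap V (∈-concatMap E (∈L₀ u∈)
          (∈-members⁺ (I u) uf)) (∈-members⁺ (flip I f) wf)) (∈-members⁺ (I w) wg))
        where
        ∈L₀ : ∀ {u} → u ≡ v ⊎ I u e ≡ true → u ∈ L₀
        ∈L₀ (inj₁ refl) = here refl
        ∈L₀ (inj₂ p) = there (∈-members⁺ (flip I e) p)

      go : ∃ λ J → Partial J × total J ≡ suc (total I)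
      go with ∃∉ L₃ (≤-<-trans |L₃| reach<q) | ∃∉ (L₄ ++ Z) (≤-<-trans |L₄++Z| reach<n)
      ... | g , g∉ | y , y∉ with Fin.any? (λ x → I x g Bool.≟ true) | Fin.any? (λ h → I y h Bool.≟ true)
      ...   | yes (x , x∈g) | _ = Swap.swap P (proj₂ ∃v) (proj₂ ∃e) x∈g (∉L₃⇒far g∉)
      ...   | no _ | yes (h , y∈h) = Swap.swap P (proj₂ ∃v) (proj₂ ∃e) y∈h
                (∉L₃⇒far λ h∈ → y∉ (∈-++⁺ˡ (∈-concatMap V h∈ (∈-members⁺ (flip I h) y∈h))))
      ...   | no ¬g | no ¬y = place P (1≤t (y∉ ∘ ∈-++⁺ʳ L₄)) 1≤k (λ e p → ¬y (e , p)) (λ v p → ¬g (v , p))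

    complete : ∀ m {I : Incidence n q} → Partial I → m + total I ≡ sum t →
               ∃ λ J → Partial J × total J ≡ sum t
    complete zero {I} P eq = I , P , eq
    complete (suc m) {I} P eq with augment P (subst (total I <_) eq (s≤s (m≤n+m _ m)))
    ... | J , PJ , eqJ = complete m PJ (trans (cong (m +_) eqJ) (trans (+-suc m _) eq))

    -- The filling starts with no incidences. Once the total reaches `sum t`, no upper bound on a
    -- degree or a size can be strict.
    linear-design : ∃ λ (I : Incidence n q) → Linear I × (∀ v → degree I v ≡ t v) × (∀ e → size I e ≡ k)
    linear-design with complete (sum t) {λ _ _ → false} P₀ eq₀
      where
      P₀ : Partial (λ _ _ → false)
      P₀ = record { linear = λ _ _ () ; degree≤t = λ v → subst (_≤ t v) (sym (card≡0 {q} {λ _ → false} λ _ ())) z≤n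
                  ; size≤k = λ e → subst (_≤ k) (sym (card≡0 {n} {λ _ → false} λ _ ())) z≤n }
      eq₀ : sum t + total {n} {q} (λ _ _ → false) ≡ sum t
      eq₀ = trans (cong (sum t +_) (trans (sum-cong-≗ {n} λ _ → card≡0 {q} {λ _ → false} λ _ ())
        (trans (sum-const n 0) (*-zeroʳ n)))) (+-identityʳ _)
    ... | I , P , eq = I , linear , ≤∧sum≡⇒≗ degree≤t eq ,
        ≤∧sum≡⇒≗ size≤k (trans (sym (total≡sum-size I)) (trans eq (trans ∑t (sym (sum-const q k)))))
      where open Partial P

-- Degrees and k-subsets

∣∣≡card : (e : Subset n) → ∣ e ∣ ≡ card (Vec.lookup e)
∣∣≡card [] = refl
∣∣≡card (inside ∷ e) = cong suc (∣∣≡card e)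
∣∣≡card (outside ∷ e) = ∣∣≡card e

∈-tabulateᵇ⁺ : (p : Fin n → Bool) {v : Fin n} → p v ≡ true → v ∈ₛ Vec.tabulate p
∈-tabulateᵇ⁺ p {v} eq = lookup⇒[]= v _ (trans (lookup∘tabulate p v) eq)

∈-tabulateᵇ⁻ : (p : Fin n → Bool) {v : Fin n} → v ∈ₛ Vec.tabulate p → p v ≡ true
∈-tabulateᵇ⁻ p {v} v∈ = trans (sym (lookup∘tabulate p v)) ([]=⇒lookup v∈)

∣tabulate∣ : (p : Fin n → Bool) → ∣ Vec.tabulate p ∣ ≡ card p
∣tabulate∣ p = trans (∣∣≡card (Vec.tabulate p)) (sum-cong-≗ λ v → cong ⟦_⟧ (lookup∘tabulate p v))

deg : Fin n → Hypergraph n → ℕ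
deg v H = ℕ.sum (map (λ e → ⟦ Vec.lookup e v ⟧) H)

deg-++ : (v : Fin n) (H H′ : Hypergraph n) → deg v (H ++ H′) ≡ deg v H + deg v H′
deg-++ v H H′ = trans (cong ℕ.sum (map-++ _ H H′)) (ℕ.sum-++ (map _ H) _)

deg-↭ : (v : Fin n) {H H′ : Hypergraph n} → H ↭ H′ → deg v H ≡ deg v H′
deg-↭ v p = ℕ.sum-↭ (map⁺ _ p)

∈⇒⟦⟧≡1 : {v : Fin n} {e : Subset n} → v ∈ₛ e → ⟦ Vec.lookup e v ⟧ ≡ 1
∈⇒⟦⟧≡1 v∈e = cong ⟦_⟧ ([]=⇒lookup v∈e)

∉⇒⟦⟧≡0 : {v : Fin n} {e : Subset n} → v ∉ₛ e → ⟦ Vec.lookup e v ⟧ ≡ 0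
∉⇒⟦⟧≡0 {v = v} {e} v∉e = cong ⟦_⟧ (Bool.¬-not (v∉e ∘ lookup⇒[]= v e))

deg≡0 : (v : Fin n) (H : Hypergraph n) → (∀ {e} → e ∈ H → v ∉ₛ e) → deg v H ≡ 0
deg≡0 v [] h = refl
deg≡0 v (e ∷ H) h = cong₂ _+_ (∉⇒⟦⟧≡0 (h (here refl))) (deg≡0 v H (h ∘ there))

deg-tabulate : ∀ {q} (v : Fin n) (c : Fin q → Subset n) →
               deg v (tabulate c) ≡ card (λ e → Vec.lookup (c e) v)
deg-tabulate {q = zero} v c = refl
deg-tabulate {q = suc q} v c = cong (⟦ Vec.lookup (c zero) v ⟧ +_) (deg-tabulate v (c ∘ suc))

-- Handshake identity, by double counting the incidences.
sum-deg : (H : Hypergraph n) → sum (λ v → deg v H) ≡ ℕ.sum (map ∣_∣ H)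
sum-deg {n} [] = trans (sum-const n 0) (*-zeroʳ n)
sum-deg (e ∷ H) = trans (∑-distrib-+ (λ v → ⟦ Vec.lookup e v ⟧) (λ v → deg v H))
  (cong₂ _+_ (sym (∣∣≡card e)) (sum-deg H))

sum-deg-uniform : (H : Hypergraph n) → All (λ e → ∣ e ∣ ≡ k) H → sum (λ v → deg v H) ≡ length H * k
sum-deg-uniform H u = trans (sum-deg H) (go H u)
  where
  go : ∀ H → All (λ e → ∣ e ∣ ≡ k) H → ℕ.sum (map ∣_∣ H) ≡ length H * k
  go [] [] = refl
  go (e ∷ H) (p ∷ u) = cong₂ _+_ p (go H u)

-- The edge list of the complete uniform hypergraph on `S`; splitting by the first element follows
-- Pascal's rule.
subsets : Subset n → ℕ → List (Subset n)
subsets [] zero = [] ∷ []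
subsets [] (suc k) = []
subsets (outside ∷ S) k = map (outside ∷_) (subsets S k)
subsets (inside ∷ S) zero = map (outside ∷_) (subsets S zero)
subsets (inside ∷ S) (suc k) = map (inside ∷_) (subsets S k) ++ map (outside ∷_) (subsets S (suc k))

length-subsets : (S : Subset n) (k : ℕ) → length (subsets S k) ≡ ∣ S ∣ C k
length-subsets [] zero = refl
length-subsets [] (suc k) = sym (k>n⇒nCk≡0 {0} {suc k} (s≤s z≤n))
length-subsets (outside ∷ S) k = trans (length-map _ (subsets S k)) (length-subsets S k)
length-subsets (inside ∷ S) zero = trans (length-map _ (subsets S zero)) (length-subsets S zero)
length-subsets (inside ∷ S) (suc k) = trans (length-++ (map (inside ∷_) (subsets S k))) (trans
  (cong₂ _+_ (trans (length-map _ (subsets S k)) (length-subsets S k))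
             (trans (length-map _ (subsets S (suc k))) (length-subsets S (suc k))))
  (nCk+nC[k+1]≡[n+1]C[k+1] ∣ S ∣ k))

∈-subsets⁺ : (S e : Subset n) → e ⊆ S → ∀ {k} → ∣ e ∣ ≡ k → e ∈ subsets S k
∈-subsets⁺ [] [] _ refl = here refl
∈-subsets⁺ (outside ∷ S) (outside ∷ e) h eq = ∈-map⁺ _ (∈-subsets⁺ S e (drop-∷-⊆ h) eq)
∈-subsets⁺ (outside ∷ S) (inside ∷ e) h eq with h here
... | ()
∈-subsets⁺ (inside ∷ S) (outside ∷ e) h {zero} eq = ∈-map⁺ _ (∈-subsets⁺ S e (drop-∷-⊆ h) eq)
∈-subsets⁺ (inside ∷ S) (outside ∷ e) h {suc k} eq =
  ∈-++⁺ʳ (map (inside ∷_) (subsets S k)) (∈-map⁺ _ (∈-subsets⁺ S e (drop-∷-⊆ h) eq))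
∈-subsets⁺ (inside ∷ S) (inside ∷ e) h refl = ∈-++⁺ˡ (∈-map⁺ _ (∈-subsets⁺ S e (drop-∷-⊆ h) refl))

∈-subsets⁻ : (S : Subset n) (k : ℕ) {e : Subset n} → e ∈ subsets S k → e ⊆ S × ∣ e ∣ ≡ k
∈-subsets⁻ [] zero (here refl) = id , refl
∈-subsets⁻ (outside ∷ S) k e∈ with ∈-map⁻ (outside ∷_) e∈
... | e′ , e′∈ , refl with ∈-subsets⁻ S k e′∈
...   | h , eq = out⊆ h , eq
∈-subsets⁻ (inside ∷ S) zero e∈ with ∈-map⁻ (outside ∷_) e∈
... | e′ , e′∈ , refl with ∈-subsets⁻ S zero e′∈
...   | h , eq = out⊆ h , eq
∈-subsets⁻ (inside ∷ S) (suc k) e∈ with ∈-++⁻ (map (inside ∷_) (subsets S k)) e∈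
... | inj₁ e∈′ with ∈-map⁻ (inside ∷_) e∈′
...   | e′ , e′∈ , refl with ∈-subsets⁻ S k e′∈
...     | h , eq = in⊆in h , cong suc eq
∈-subsets⁻ (inside ∷ S) (suc k) e∈ | inj₂ e∈′ with ∈-map⁻ (outside ∷_) e∈′
...   | e′ , e′∈ , refl with ∈-subsets⁻ S (suc k) e′∈
...     | h , eq = out⊆ h , eq

subsets-unique : (S : Subset n) (k : ℕ) → Unique (subsets S k)
subsets-unique [] zero = [] ∷ []
subsets-unique [] (suc k) = []
subsets-unique (outside ∷ S) k = Unique.map⁺ Vec.∷-injectiveʳ (subsets-unique S k)
subsets-unique (inside ∷ S) zero = Unique.map⁺ Vec.∷-injectiveʳ (subsets-unique S zero)
subsets-unique (inside ∷ S) (suc k) = Unique.++⁺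
  (Unique.map⁺ Vec.∷-injectiveʳ (subsets-unique S k))
  (Unique.map⁺ Vec.∷-injectiveʳ (subsets-unique S (suc k))) disj
  where
  disj : ∀ {e} → ¬ (e ∈ map (inside ∷_) (subsets S k) × e ∈ map (outside ∷_) (subsets S (suc k)))
  disj (p , q) with ∈-map⁻ (inside ∷_) p | ∈-map⁻ (outside ∷_) q
  ... | _ , _ , refl | _ , _ , ()

deg-map-∷ : (v : Fin n) (b : Bool) (H : Hypergraph n) → deg (suc v) (map (b ∷_) H) ≡ deg v H
deg-map-∷ v b H = cong ℕ.sum (sym (map-∘ H))

deg-map-inside : (H : Hypergraph n) → deg zero (map (inside ∷_) H) ≡ length H
deg-map-inside [] = refl
deg-map-inside (e ∷ H) = cong suc (deg-map-inside H)

deg-map-outside : (H : Hypergraph n) → deg zero (map (outside ∷_) H) ≡ 0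
deg-map-outside [] = refl
deg-map-outside (e ∷ H) = deg-map-outside H

∈⇒∣∣≡suc : {v : Fin n} {S : Subset n} → v ∈ₛ S → ∃ λ m → ∣ S ∣ ≡ suc m
∈⇒∣∣≡suc {S = inside ∷ S} _ = _ , refl
∈⇒∣∣≡suc {S = outside ∷ S} (there v∈) = ∈⇒∣∣≡suc v∈

-- An edge through `v` is fixed by its other `k` vertices in `S`. This is the binomial coefficient
-- of the admissibility condition.
deg-subsets : {v : Fin n} {S : Subset n} → v ∈ₛ S → ∀ k → deg v (subsets S (suc k)) ≡ (∣ S ∣ ∸ 1) C k
deg-subsets {v = zero} {inside ∷ S} here k = begin
  deg zero (map (inside ∷_) (subsets S k) ++ map (outside ∷_) (subsets S (suc k)))
    ≡⟨ deg-++ zero (map (inside ∷_) (subsets S k)) _ ⟩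
  _ ≡⟨ cong₂ _+_ (trans (deg-map-inside (subsets S k)) (length-subsets S k)) (deg-map-outside (subsets S (suc k))) ⟩
  ∣ S ∣ C k + 0 ≡⟨ +-identityʳ _ ⟩
  ∣ S ∣ C k ∎
  where open ≡-Reasoning
deg-subsets {v = suc v} {outside ∷ S} (there v∈) k =
  trans (deg-map-∷ v outside (subsets S (suc k))) (deg-subsets v∈ k)
deg-subsets {v = suc v} {inside ∷ S} (there v∈) k = begin
  deg (suc v) (map (inside ∷_) (subsets S k) ++ map (outside ∷_) (subsets S (suc k)))
    ≡⟨ deg-++ (suc v) (map (inside ∷_) (subsets S k)) _ ⟩
  _ ≡⟨ cong₂ _+_ (deg-map-∷ v inside (subsets S k)) (trans (deg-map-∷ v outside (subsets S (suc k))) (deg-subsets v∈ k)) ⟩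
  deg v (subsets S k) + (∣ S ∣ ∸ 1) C k ≡⟨ pascal k ⟩
  ∣ S ∣ C k ∎
  where
  open ≡-Reasoning
  pascal : ∀ k → deg v (subsets S k) + (∣ S ∣ ∸ 1) C k ≡ ∣ S ∣ C k
  -- The induction covers positive sizes only; for size 0, the empty set does not contain `v`.
  pascal zero = cong (_+ 1) (deg≡0 v (subsets S 0) λ e∈ v∈e →
    contradiction (trans (sym (proj₂ (∈-subsets⁻ S 0 e∈))) (proj₂ (∈⇒∣∣≡suc v∈e))) λ ())
  pascal (suc k) with ∈⇒∣∣≡suc v∈
  ... | m , eq = begin
    deg v (subsets S (suc k)) + (∣ S ∣ ∸ 1) C suc k ≡⟨ cong (_+ (∣ S ∣ ∸ 1) C suc k) (deg-subsets v∈ k) ⟩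
    (∣ S ∣ ∸ 1) C k + (∣ S ∣ ∸ 1) C suc k ≡⟨ cong (λ s → (s ∸ 1) C k + (s ∸ 1) C suc k) eq ⟩
    m C k + m C suc k ≡⟨ nCk+nC[k+1]≡[n+1]C[k+1] m k ⟩
    suc m C suc k ≡⟨ cong (_C suc k) eq ⟨
    ∣ S ∣ C suc k ∎

-- Berge stars and the lower bound

-- The centre is split off and the edges and leaves are indexed by `Fin ℓ` directly, instead of by
-- positions in the edge list of `star ℓ`.
BergeStar : ℕ → Hypergraph n → Fin n → Set
BergeStar {n} ℓ H v =
  Σ (Fin ℓ → Fin (length H)) λ f → Σ (Fin ℓ → Fin n) λ w →
    Injective _≡_ _≡_ f × Injective _≡_ _≡_ w × (∀ i → w i ≢ v) ×
    (∀ i → v ∈ₛ lookup H (f i) × w i ∈ₛ lookup H (f i))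

length-star : ∀ ℓ → length (edges (star ℓ)) ≡ ℓ
length-star ℓ = trans (length-map _ (allFin ℓ)) (length-tabulate {n = ℓ} id)

lookup-map-tabulate : ∀ {A B : Set} {m} (f : A → B) (g : Fin m → A) .(eq : length (map f (tabulate g)) ≡ m) j →
                      lookup (map f (tabulate g)) j ≡ f (g (cast eq j))
lookup-map-tabulate {m = suc m} f g eq zero = refl
lookup-map-tabulate {m = suc m} f g eq (suc j) = lookup-map-tabulate f (g ∘ suc) (suc-injective eq) j

lookup-star : ∀ ℓ j → lookup (edges (star ℓ)) j ≡ (zero , suc (cast (length-star ℓ) j))
lookup-star ℓ j = lookup-map-tabulate _ id (length-star ℓ) j

cast-injective : ∀ {m n} .(eq : m ≡ n) → Injective _≡_ _≡_ (cast eq)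
cast-injective eq {i} {j} p =
  Fin.toℕ-injective (trans (sym (Fin.toℕ-cast eq i)) (trans (cong Fin.toℕ p) (Fin.toℕ-cast eq j)))

containsBerge⇒star : {H : Hypergraph n} → ContainsBerge (star ℓ) H → ∃ (BergeStar ℓ H)
containsBerge⇒star {ℓ = ℓ} {H} (ψ , φ , ψ-inj , φ-inj , inc) =
  ψ zero , φ ∘ pos , ψ ∘ suc , cast-injective _ ∘ φ-inj , Fin.suc-injective ∘ ψ-inj ,
  (λ i p → contradiction (ψ-inj p) λ ()) , mem
  where
  pos : Fin ℓ → Fin (length (edges (star ℓ)))
  pos = cast (sym (length-star ℓ))
  mem : ∀ i → ψ zero ∈ₛ lookup H (φ (pos i)) × ψ (suc i) ∈ₛ lookup H (φ (pos i))
  mem i with inc (pos i)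
  ... | p rewrite lookup-star ℓ (pos i) | Fin.cast-involutive (length-star ℓ) (sym (length-star ℓ)) i = p

star⇒containsBerge : {H : Hypergraph n} {v : Fin n} → BergeStar ℓ H v → ContainsBerge (star ℓ) H
star⇒containsBerge {n} {ℓ} {H} {v} (f , w , f-inj , w-inj , w≢v , inc) =
  ψ , f ∘ cast (length-star ℓ) , ψ-inj , cast-injective _ ∘ f-inj , mem
  where
  ψ : Fin (suc ℓ) → Fin n
  ψ zero = v
  ψ (suc i) = w i
  ψ-inj : Injective _≡_ _≡_ ψ
  ψ-inj {zero} {zero} _ = refl
  ψ-inj {zero} {suc j} p = contradiction (sym p) (w≢v j)
  ψ-inj {suc i} {zero} p = contradiction p (w≢v i)
  ψ-inj {suc i} {suc j} p = cong suc (w-inj p)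
  mem : ∀ j → let uv = lookup (edges (star ℓ)) j ; e = lookup H (f (cast (length-star ℓ) j)) in
        ψ (proj₁ uv) ∈ₛ e × ψ (proj₂ uv) ∈ₛ e
  mem j rewrite lookup-star ℓ j = inc (cast (length-star ℓ) j)

injective⇒≤card : ∀ {m N} (p : Fin N → Bool) (f : Fin m → Fin N) → Injective _≡_ _≡_ f →
              (∀ i → p (f i) ≡ true) → m ≤ card p
injective⇒≤card {m} p f f-inj h = subst₂ _≤_ (length-tabulate f) (length-members p)
  (length-⊆ (Unique.tabulate⁺ {f = f} f-inj) inMembers)
  where
  inMembers : ∀ {x} → x ∈ tabulate f → x ∈ members p
  inMembers x∈ with ∈-tabulate⁻ x∈
  ... | i , refl = ∈-members⁺ p (h i)

deg≡card-lookup : (v : Fin n) (H : Hypergraph n) → deg v H ≡ card (λ i → Vec.lookup (lookup H i) v)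
deg≡card-lookup v H = trans (cong (deg v) (sym (tabulate-lookup H))) (deg-tabulate v (lookup H))

star⇒ℓ≤deg : {H : Hypergraph n} {v : Fin n} → BergeStar ℓ H v → ℓ ≤ deg v H
star⇒ℓ≤deg {H = H} {v} (f , w , f-inj , _ , _ , inc) = subst (_ ≤_) (sym (deg≡card-lookup v H))
  (injective⇒≤card _ f f-inj λ i → []=⇒lookup (proj₁ (inc i)))

-- Every edge of the Berge star contains its centre, so `e` is not among them.
star-drop : {H : Hypergraph n} {e : Subset n} {v : Fin n} → v ∉ₛ e → BergeStar ℓ (e ∷ H) v → BergeStar ℓ H v
star-drop {ℓ = ℓ} {H} {e} {v} v∉e (f , w , f-inj , w-inj , w≢v , inc) =
  (λ i → proj₁ (pred (f i) (proj₁ (inc i)))) , w ,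
  (λ {i} {j} p → f-inj (trans (proj₂ (pred (f i) _)) (trans (cong suc p) (sym (proj₂ (pred (f j) _)))))) ,
  w-inj , w≢v , λ i → subst (λ x → v ∈ₛ lookup (e ∷ H) x × w i ∈ₛ lookup (e ∷ H) x) (proj₂ (pred (f i) _)) (inc i)
  where
  pred : ∀ x → v ∈ₛ lookup (e ∷ H) x → ∃ λ y → x ≡ suc y
  pred zero v∈ = contradiction v∈ v∉e
  pred (suc y) _ = y , refl

ceilDiv≤ : ∀ m k x → m ≤ x * k → ceilDiv m k ≤ x
ceilDiv≤ m zero x h = z≤n
ceilDiv≤ m (suc j) x h = m<1+n⇒m≤n (m<n*o⇒m/o<n (begin-strict
  m + j ≤⟨ +-monoˡ-≤ j h ⟩
  x * suc j + j <⟨ +-monoʳ-< (x * suc j) (n<1+n j) ⟩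
  x * suc j + suc j ≡⟨ +-comm (x * suc j) (suc j) ⟩
  suc x * suc j ∎))
  where open ≤-Reasoning

module _ {l : ℕ} {H : Hypergraph n} (sat : IsBergeSaturated (suc k) (star (suc (suc l))) H) where

  private
    -- Here ℓ is `suc (suc l)`, so degree at most `l` means degree less than ℓ - 1.
    low : Fin n → Bool
    low v = deg v H ≤ᵇ l

    A : Subset n
    A = Vec.tabulate low

    ∈A⇒≤ : ∀ {v} → v ∈ₛ A → deg v H ≤ l
    ∈A⇒≤ {v} v∈ = ≤ᵇ⇒≤ _ _ (Equivalence.from Bool.T-≡ (∈-tabulateᵇ⁻ low v∈))

    ∉A⇒> : ∀ {v} → v ∉ₛ A → l < deg v H
    ∉A⇒> v∉ = ≰⇒> λ h → v∉ (∈-tabulateᵇ⁺ low (Equivalence.to Bool.T-≡ (≤⇒≤ᵇ h)))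

  -- If `e` were missing, adding it would complete a star whose centre lies in `e`. That centre then
  -- has degree at least `suc (suc l)`, whereas a vertex of `A` reaches at most `suc l`.
  low-clique : ∀ {e} → e ⊆ A → ∣ e ∣ ≡ suc k → e ∈ H
  low-clique {e} e⊆A |e| with Any.any? (≡-dec Bool._≟_ e) H
  ... | yes e∈H = e∈H
  ... | no e∉H with containsBerge⇒star (proj₂ (proj₂ sat) e |e| e∉H)
  ...   | v , s with v ∈? e
  ...     | no v∉e = contradiction (star⇒containsBerge {H = H} (star-drop {H = H} v∉e s)) (proj₁ (proj₂ sat))
  ...     | yes v∈e = contradiction (begin
    suc (suc l) ≤⟨ star⇒ℓ≤deg {H = e ∷ H} s ⟩
    ⟦ Vec.lookup e v ⟧ + deg v H ≡⟨ cong (_+ deg v H) (∈⇒⟦⟧≡1 v∈e) ⟩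
    suc (deg v H) ≤⟨ s≤s (∈A⇒≤ (e⊆A v∈e)) ⟩
    suc l ∎) (<⇒≱ ≤-refl)
    where open ≤-Reasoning

  -- The witness may be 0, which is not admissible.
  saturated-lower-bound : ∃ λ a → a ≤ n × (1 ≤ a → (a ∸ 1) C k ≤ l) × rhsTerm (suc k) (suc (suc l)) n a ≤ length H
  saturated-lower-bound with ⊆⇒↭++ (subsets-unique A (suc k))
    (λ e∈ → low-clique (proj₁ (∈-subsets⁻ A (suc k) e∈)) (proj₂ (∈-subsets⁻ A (suc k) e∈)))
  ... | rest , perm = ∣ A ∣ , ∣p∣≤n A , adm , bound
    where
    degH : ∀ v → deg v H ≡ deg v (subsets A (suc k)) + deg v rest
    degH v = trans (deg-↭ v perm) (deg-++ v (subsets A (suc k)) rest)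

    -- The subsets of `A` alone already give a vertex of `A` this degree.
    adm : 1 ≤ ∣ A ∣ → (∣ A ∣ ∸ 1) C k ≤ l
    adm 1≤ with nonempty? A
    ... | yes (v , v∈A) = begin
      (∣ A ∣ ∸ 1) C k ≡⟨ deg-subsets v∈A k ⟨
      deg v (subsets A (suc k)) ≤⟨ m≤m+n _ _ ⟩
      deg v (subsets A (suc k)) + deg v rest ≡⟨ degH v ⟨
      deg v H ≤⟨ ∈A⇒≤ v∈A ⟩
      l ∎
      where open ≤-Reasoning
    ... | no ¬ne = contradiction 1≤ (<⇒≱ (s≤s (≤-reflexive
      (trans (∣∣≡card A) (card≡0 λ v p → ¬ne (v , lookup⇒[]= v A p))))))

    -- A vertex outside `A` lies in no subset of `A`, so `rest` accounts for its whole degree.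
    -- Summing over all vertices gives `rest-count`.
    rest-deg : ∀ v → suc l * ⟦ Vec.lookup (∁ A) v ⟧ ≤ deg v rest
    rest-deg v with v ∈? ∁ A
    ... | no v∉ rewrite ∉⇒⟦⟧≡0 v∉ | *-zeroʳ l = z≤n
    ... | yes v∈ rewrite ∈⇒⟦⟧≡1 v∈ | *-identityʳ l = begin
      suc l ≤⟨ ∉A⇒> (x∈∁p⇒x∉p v∈) ⟩
      deg v H ≡⟨ degH v ⟩
      deg v (subsets A (suc k)) + deg v rest
        ≡⟨ cong (_+ deg v rest) (deg≡0 v (subsets A (suc k)) λ e∈ v∈e → x∈∁p⇒x∉p v∈ (proj₁ (∈-subsets⁻ A (suc k) e∈) v∈e)) ⟩
      deg v rest ∎
      where open ≤-Reasoning

    rest-count : suc l * (n ∸ ∣ A ∣) ≤ length rest * suc k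
    rest-count = begin
      suc l * (n ∸ ∣ A ∣) ≡⟨ cong (suc l *_) (trans (sym (∣∁p∣≡n∸∣p∣ A)) (∣∣≡card (∁ A))) ⟩
      suc l * card (Vec.lookup (∁ A)) ≡⟨ sum-*ˡ (suc l) (λ v → ⟦ Vec.lookup (∁ A) v ⟧) ⟨
      sum (λ v → suc l * ⟦ Vec.lookup (∁ A) v ⟧) ≤⟨ sum-mono-≤ rest-deg ⟩
      sum (λ v → deg v rest) ≡⟨ sum-deg-uniform rest (All.++⁻ʳ (subsets A (suc k)) (All-resp-↭ perm (proj₂ (proj₁ sat)))) ⟩
      length rest * suc k ∎
      where open ≤-Reasoning

    bound : rhsTerm (suc k) (suc (suc l)) n ∣ A ∣ ≤ length H
    bound = begin
      ceilDiv (suc l * (n ∸ ∣ A ∣)) (suc k) + ∣ A ∣ C suc k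
        ≤⟨ +-mono-≤ (ceilDiv≤ _ (suc k) (length rest) rest-count) (≤-reflexive (sym (length-subsets A (suc k)))) ⟩
      length rest + length (subsets A (suc k)) ≡⟨ +-comm (length rest) _ ⟩
      length (subsets A (suc k)) + length rest ≡⟨ length-++ (subsets A (suc k)) ⟨
      length (subsets A (suc k) ++ rest) ≡⟨ ↭-length perm ⟨
      length H ∎
      where open ≤-Reasoning

-- Enumerations, initial segments and rounding up

lookup-injective : ∀ {A : Set} {xs : List A} → Unique xs → Injective _≡_ _≡_ (lookup xs)
lookup-injective (_ ∷ _) {zero} {zero} _ = refl
lookup-injective (x∉ ∷ _) {zero} {suc j} p = contradiction p (All.lookup x∉ (∈-lookup j))
lookup-injective (x∉ ∷ _) {suc i} {zero} p = contradiction (sym p) (All.lookup x∉ (∈-lookup i))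
lookup-injective (_ ∷ u) {suc i} {suc j} p = cong suc (lookup-injective u p)

enumerate : ∀ {m} (p : Fin n → Bool) → m ≤ card p →
            Σ (Fin m → Fin n) λ g → Injective _≡_ _≡_ g × (∀ i → p (g i) ≡ true)
enumerate {m = m} p m≤ = (λ i → lookup (members p) (Fin.inject≤ i m≤′)) ,
  (λ eq → Fin.inject≤-injective m≤′ m≤′ _ _ (lookup-injective (members-unique p) eq)) ,
  λ i → ∈-members⁻ {p = p} (∈-lookup (Fin.inject≤ i m≤′))
  where
  m≤′ : m ≤ length (members p)
  m≤′ = subst (m ≤_) (sym (length-members p)) m≤

1≤card : (p : Fin n → Bool) {i : Fin n} → p i ≡ true → 1 ≤ card p
1≤card p {i} eq = injective⇒≤card {1} p (λ _ → i) (λ { {zero} {zero} _ → refl }) (λ _ → eq)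

card-<ᵇ : ∀ {a n} → a ≤ n → card {n} (λ v → Fin.toℕ v <ᵇ a) ≡ a
card-<ᵇ {zero} {n} _ = card≡0 {n} {λ v → Fin.toℕ v <ᵇ 0} λ _ ()
card-<ᵇ {suc a} {suc n} (s≤s h) = cong suc (card-<ᵇ h)

card-not : (p : Fin n → Bool) → card p + card (not ∘ p) ≡ n
card-not {n} p = trans (sym (∑-distrib-+ (λ i → ⟦ p i ⟧) (λ i → ⟦ not (p i) ⟧)))
  (trans (sum-cong-≗ (λ i → go (p i))) (trans (sum-const n 1) (*-identityʳ n)))
  where
  go : ∀ b → ⟦ b ⟧ + ⟦ not b ⟧ ≡ 1
  go true = refl
  go false = refl

<ᵇ-mono : ∀ m {r a} → r ≤ a → (m <ᵇ r) ≡ true → (m <ᵇ a) ≡ true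
<ᵇ-mono m {r} r≤a eq = Equivalence.to Bool.T-≡ (<⇒<ᵇ (<-≤-trans (<ᵇ⇒< m r (Equivalence.from Bool.T-≡ eq)) r≤a))

-- Rounding up overshoots `m` by `j ∸ ρ`, where `ρ` is the remainder of `m + j`. In the construction
-- this excess is the number `r` of incidences given to vertices of `A`.
ceilDiv-* : ∀ m j → ∃ λ r → r ≤ j × r + m ≡ ceilDiv m (suc j) * suc j
ceilDiv-* m j = j ∸ ρ , m∸n≤m j ρ , +-cancelʳ-≡ ρ _ _ (begin
  j ∸ ρ + m + ρ   ≡⟨ +-assoc (j ∸ ρ) m ρ ⟩
  j ∸ ρ + (m + ρ) ≡⟨ cong (j ∸ ρ +_) (+-comm m ρ) ⟩
  j ∸ ρ + (ρ + m) ≡⟨ +-assoc (j ∸ ρ) ρ m ⟨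
  j ∸ ρ + ρ + m   ≡⟨ cong (_+ m) (m∸n+n≡m (m<1+n⇒m≤n (m%n<n (m + j) (suc j)))) ⟩
  j + m           ≡⟨ +-comm j m ⟩
  m + j           ≡⟨ m≡m%n+[m/n]*n (m + j) (suc j) ⟩
  ρ + (m + j) / suc j * suc j ≡⟨ +-comm ρ _ ⟩
  (m + j) / suc j * suc j + ρ ∎)
  where
  open ≡-Reasoning
  ρ = (m + j) % suc j

-- The upper bound

-- The uniformity is suc k and ℓ = suc d, with d = suc l.
module Construction (k l n a : ℕ) (2≤k : 2 ≤ k) (k≤a : k ≤ a) (a≤n : a ≤ n)
  (adm : (a ∸ 1) C k ≤ l) (large : reach (suc k) (suc l) * suc k + a < n) where

  d Q r : ℕ
  d = suc l
  Q = ceilDiv (d * (n ∸ a)) (suc k)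
  r = proj₁ (ceilDiv-* (d * (n ∸ a)) k)

  r≤k : r ≤ k
  r≤k = proj₁ (proj₂ (ceilDiv-* (d * (n ∸ a)) k))

  -- The hypothesis `k ≤ a` leaves room in `A` for `r` vertices of degree 1.
  r≤a : r ≤ a
  r≤a = ≤-trans r≤k k≤a

  r+d[n∸a]≡Qk : r + d * (n ∸ a) ≡ Q * suc k
  r+d[n∸a]≡Qk = proj₂ (proj₂ (ceilDiv-* (d * (n ∸ a)) k))

  -- Both are initial segments, so the second lies inside the first.
  inA inR : Fin n → Bool
  inA v = Fin.toℕ v <ᵇ a
  inR v = Fin.toℕ v <ᵇ r

  A : Subset n
  A = Vec.tabulate inA

  ∣A∣≡a : ∣ A ∣ ≡ a
  ∣A∣≡a = trans (∣tabulate∣ inA) (card-<ᵇ a≤n)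

  t : Fin n → ℕ
  t v = ⟦ inR v ⟧ + d * ⟦ not (inA v) ⟧

  ∑t : sum t ≡ Q * suc k
  ∑t = begin
    sum t ≡⟨ ∑-distrib-+ (λ v → ⟦ inR v ⟧) (λ v → d * ⟦ not (inA v) ⟧) ⟩
    card inR + sum (λ v → d * ⟦ not (inA v) ⟧)
      ≡⟨ cong₂ _+_ (card-<ᵇ (≤-trans r≤a a≤n)) (sum-*ˡ d (λ v → ⟦ not (inA v) ⟧)) ⟩
    r + d * card (not ∘ inA) ≡⟨ cong (λ c → r + d * c) card-out ⟩
    r + d * (n ∸ a) ≡⟨ r+d[n∸a]≡Qk ⟩
    Q * suc k ∎
    where
    open ≡-Reasoning
    card-out : card (not ∘ inA) ≡ n ∸ a
    card-out = trans (sym (m+n∸m≡n a _)) (cong (_∸ a) (trans (cong (_+ card (not ∘ inA)) (sym (card-<ᵇ a≤n))) (card-not inA)))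

  t-in : ∀ {v} → inA v ≡ true → t v ≡ ⟦ inR v ⟧
  t-in {v} eq = begin
    ⟦ inR v ⟧ + d * ⟦ not (inA v) ⟧ ≡⟨ cong (λ b → ⟦ inR v ⟧ + d * ⟦ not b ⟧) eq ⟩
    ⟦ inR v ⟧ + d * 0 ≡⟨ cong (⟦ inR v ⟧ +_) (*-zeroʳ d) ⟩
    ⟦ inR v ⟧ + 0 ≡⟨ +-identityʳ _ ⟩
    ⟦ inR v ⟧ ∎
    where open ≡-Reasoning

  t-out : ∀ {v} → inA v ≢ true → t v ≡ d
  t-out {v} neq = begin
    ⟦ inR v ⟧ + d * ⟦ not (inA v) ⟧
      ≡⟨ cong₂ (λ b b′ → ⟦ b ⟧ + d * ⟦ not b′ ⟧) (Bool.¬-not (neq ∘ <ᵇ-mono (Fin.toℕ v) r≤a)) (Bool.¬-not neq) ⟩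
    d * 1 ≡⟨ *-identityʳ d ⟩
    d ∎
    where open ≡-Reasoning

  ⟦⟧≤1 : ∀ b → ⟦ b ⟧ ≤ 1
  ⟦⟧≤1 true = ≤-refl
  ⟦⟧≤1 false = z≤n

  t≤d : ∀ v → t v ≤ d
  t≤d v with inA v Bool.≟ true
  ... | yes eq = subst (_≤ d) (sym (t-in eq)) (≤-trans (⟦⟧≤1 (inR v)) (s≤s z≤n))
  ... | no neq = ≤-reflexive (t-out neq)

  Z : List (Fin n)
  Z = members inA

  ∉Z⇒1≤t : ∀ {v} → v ∉ Z → 1 ≤ t v
  ∉Z⇒1≤t v∉ = subst (1 ≤_) (sym (t-out (v∉ ∘ ∈-members⁺ inA))) (s≤s z≤n)

  reach<Q : reach (suc k) d < Q
  reach<Q = *-cancelʳ-< (suc k) _ _ (begin-strict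
    reach (suc k) d * suc k <⟨ m+n≤o⇒m≤o∸n _ large ⟩
    n ∸ a ≤⟨ m≤n*m (n ∸ a) d ⟩
    d * (n ∸ a) ≤⟨ m≤n+m _ r ⟩
    r + d * (n ∸ a) ≡⟨ r+d[n∸a]≡Qk ⟩
    Q * suc k ∎)
    where open ≤-Reasoning

  design : ∃ λ (I : Incidence n Q) → Linear I × (∀ v → degree I v ≡ t v) × (∀ e → size I e ≡ suc k)
  design = linear-design (suc k) d t (s≤s z≤n) t≤d Z ∉Z⇒1≤t ∑t reach<Q
    (subst (λ z → reach (suc k) d * suc k + z < n) (sym (trans (length-members inA) (card-<ᵇ a≤n))) large)

  I : Incidence n Q
  I = proj₁ design

  linear : Linear I
  linear = proj₁ (proj₂ design)

  degree≡t : ∀ v → degree I v ≡ t v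
  degree≡t = proj₁ (proj₂ (proj₂ design))

  size≡k : ∀ e → size I e ≡ suc k
  size≡k = proj₂ (proj₂ (proj₂ design))

  block : Fin Q → Subset n
  block e = Vec.tabulate (flip I e)

  -- A block has `suc k` vertices, which is at least three.
  pick : ∀ e (xs : List (Fin n)) → length xs ≤ 2 → ∃ λ v → I v e ≡ true × v ∉ xs
  pick e xs h = ∃∈∉ (flip I e) xs (subst (length xs <_) (sym (size≡k e)) (s≤s (≤-trans h 2≤k)))

  common≤1 : ∀ {v w e f} → v ≢ w → I v e ≡ true → I v f ≡ true → I w e ≡ true → I w f ≡ true → e ≡ f
  common≤1 {e = e} {f} v≢w ve vf we wf with e Fin.≟ f
  ... | yes eq = eq
  ... | no neq = ⊥-elim (linear v≢w neq ve vf we wf)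

  -- By linearity, two distinct vertices of a block determine it.
  block-injective : ∀ {e f} → block e ≡ block f → e ≡ f
  block-injective {e} {f} eq with pick e [] z≤n
  ... | v , ve , _ with pick e (v ∷ []) (s≤s z≤n)
  ...   | w , we , w∉ = common≤1 (w∉ ∘ here ∘ sym) ve (transfer ve) we (transfer we)
    where
    transfer : ∀ {u} → I u e ≡ true → I u f ≡ true
    transfer p = ∈-tabulateᵇ⁻ (flip I f) (subst (_ ∈ₛ_) eq (∈-tabulateᵇ⁺ (flip I e) p))

  -- Only `r` vertices of `A` lie in any block, and `r ≤ k` is too few to fill one. Hence no block
  -- repeats an edge inside `A`.
  block⊈A : ∀ e → ¬ (block e ⊆ A)
  block⊈A e h = <⇒≱ (s≤s r≤k) (begin
    suc k ≡⟨ size≡k e ⟨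
    size I e ≤⟨ card-mono inside-R ⟩
    card inR ≡⟨ card-<ᵇ (≤-trans r≤a a≤n) ⟩
    r ∎)
    where
    open ≤-Reasoning
    inside-R : ∀ v → I v e ≡ true → inR v ≡ true
    inside-R v ve = go (inR v) (subst (1 ≤_)
      (trans (degree≡t v) (t-in (∈-tabulateᵇ⁻ inA (h (∈-tabulateᵇ⁺ (flip I e) ve))))) (1≤card (I v) ve))
      where
      go : ∀ b → 1 ≤ ⟦ b ⟧ → b ≡ true
      go true _ = refl

  H : Hypergraph n
  H = tabulate block ++ subsets A (suc k)

  length-H : length H ≡ rhsTerm (suc k) (suc d) n a
  length-H = trans (length-++ (tabulate block)) (cong₂ _+_ (length-tabulate block)
    (trans (length-subsets A (suc k)) (cong (_C suc k) ∣A∣≡a)))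

  uniform : IsUniform (suc k) H
  uniform = Unique.++⁺ (Unique.tabulate⁺ block-injective) (subsets-unique A (suc k)) disjoint
          , All.++⁺ (All.tabulate⁺ λ e → trans (∣tabulate∣ (flip I e)) (size≡k e))
                    (All.tabulate λ e∈ → proj₂ (∈-subsets⁻ A (suc k) e∈))
    where
    disjoint : ∀ {x} → ¬ (x ∈ tabulate block × x ∈ subsets A (suc k))
    disjoint (p , p′) with ∈-tabulate⁻ p
    ... | e , refl = block⊈A e (proj₁ (∈-subsets⁻ A (suc k) p′))

  -- A vertex of `A` lies in at most one block and, by admissibility, in at most `l` subsets of `A`;
  -- any other vertex lies in `d` blocks only.
  deg≤d : ∀ v → deg v H ≤ d
  deg≤d v = subst (_≤ d) (sym deg-H) bound
    where
    deg-H : deg v H ≡ t v + deg v (subsets A (suc k))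
    deg-H = trans (deg-++ v (tabulate block) _) (cong (_+ deg v (subsets A (suc k)))
      (trans (deg-tabulate v block) (trans (sum-cong-≗ λ e → cong ⟦_⟧ (lookup∘tabulate (flip I e) v)) (degree≡t v))))
    bound : t v + deg v (subsets A (suc k)) ≤ d
    bound with inA v Bool.≟ true
    ... | yes eq = +-mono-≤ (≤-trans (≤-reflexive (t-in eq)) (⟦⟧≤1 (inR v)))
      (≤-trans (≤-reflexive (trans (deg-subsets (∈-tabulateᵇ⁺ inA eq) k) (cong (λ s → (s ∸ 1) C k) ∣A∣≡a))) adm)
    ... | no neq = ≤-reflexive (trans (cong₂ _+_ (t-out neq) (deg≡0 v (subsets A (suc k))
        λ e∈ v∈e → neq (∈-tabulateᵇ⁻ inA (proj₁ (∈-subsets⁻ A (suc k) e∈) v∈e)))) (+-identityʳ d))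

  module Completion {e : Subset n} (|e| : ∣ e ∣ ≡ suc k) {v : Fin n} (v∈e : v ∈ₛ e) (v∉A : inA v ≢ true) where

    starEdges : Σ (Fin d → Fin Q) λ g → Injective _≡_ _≡_ g × (∀ i → I v (g i) ≡ true)
    starEdges = enumerate (I v) (≤-reflexive (sym (trans (degree≡t v) (t-out v∉A))))

    g : Fin d → Fin Q
    g = proj₁ starEdges

    v∈g : ∀ i → I v (g i) ≡ true
    v∈g = proj₂ (proj₂ starEdges)

    other : ∃ λ u → Vec.lookup e u ≡ true × u ∉ v ∷ []
    other = ∃∈∉ (Vec.lookup e) (v ∷ []) (subst (1 <_) (trans (sym |e|) (∣∣≡card e)) (s≤s (≤-trans (s≤s z≤n) 2≤k)))

    u : Fin n
    u = proj₁ other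

    -- Avoiding `u` keeps these leaves apart from the leaf reserved for `e`.
    leaf : ∀ i → ∃ λ x → I x (g i) ≡ true × x ∉ v ∷ u ∷ []
    leaf i = pick (g i) (v ∷ u ∷ []) ≤-refl

    block∈H : ∀ c → block c ∈ H
    block∈H c = ∈-++⁺ˡ (∈-tabulate⁺ c)

    pos : Fin Q → Fin (length H)
    pos c = Any.index (block∈H c)

    lookup-pos : ∀ c → block c ≡ lookup H (pos c)
    lookup-pos c = Any.lookup-index (block∈H c)

    f : Fin (suc d) → Fin (suc (length H))
    f zero = zero
    f (suc i) = suc (pos (g i))

    w : Fin (suc d) → Fin n
    w zero = u
    w (suc i) = proj₁ (leaf i)

    f-injective : Injective _≡_ _≡_ f
    f-injective {zero} {zero} _ = refl
    f-injective {suc i} {suc j} p = cong suc (proj₁ (proj₂ starEdges) (block-injective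
      (trans (lookup-pos (g i)) (trans (cong (lookup H) (Fin.suc-injective p)) (sym (lookup-pos (g j)))))))

    w≢v : ∀ i → w i ≢ v
    w≢v zero p = proj₂ (proj₂ other) (here p)
    w≢v (suc i) p = proj₂ (proj₂ (leaf i)) (here p)

    w-injective : Injective _≡_ _≡_ w
    w-injective {zero} {zero} _ = refl
    w-injective {zero} {suc j} p = contradiction (there (here (sym p))) (proj₂ (proj₂ (leaf j)))
    w-injective {suc i} {zero} p = contradiction (there (here p)) (proj₂ (proj₂ (leaf i)))
    -- Two blocks with the same leaf share it and `v`, so they are equal by linearity.
    w-injective {suc i} {suc j} p = cong suc (proj₁ (proj₂ starEdges) (common≤1 (w≢v (suc i) ∘ sym)
      (v∈g i) (v∈g j) (proj₁ (proj₂ (leaf i))) (subst (λ x → I x (g j) ≡ true) (sym p) (proj₁ (proj₂ (leaf j))))))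

    incident : ∀ i → v ∈ₛ lookup (e ∷ H) (f i) × w i ∈ₛ lookup (e ∷ H) (f i)
    incident zero = v∈e , lookup⇒[]= u e (proj₁ (proj₂ other))
    incident (suc i) = subst (λ b → v ∈ₛ b × w (suc i) ∈ₛ b) (lookup-pos (g i))
      (∈-tabulateᵇ⁺ (flip I (g i)) (v∈g i) , ∈-tabulateᵇ⁺ (flip I (g i)) (proj₁ (proj₂ (leaf i))))

    bergeStar : BergeStar (suc d) (e ∷ H) v
    bergeStar = f , w , f-injective , w-injective , w≢v , incident

  saturated : IsBergeSaturated (suc k) (star (suc d)) H
  saturated = uniform , free , completes
    where
    free : ¬ ContainsBerge (star (suc d)) H
    free B with containsBerge⇒star {H = H} B
    ... | v , s = <⇒≱ (s≤s (deg≤d v)) (star⇒ℓ≤deg {H = H} s)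
    completes : ∀ e → ∣ e ∣ ≡ suc k → ¬ (e ∈ H) → ContainsBerge (star (suc d)) (e ∷ H)
    completes e |e| e∉H with Fin.any? (λ v → (v ∈? e) ×-dec ¬? (inA v Bool.≟ true))
    ... | yes (v , v∈e , v∉A) = star⇒containsBerge {H = e ∷ H} (Completion.bergeStar |e| v∈e v∉A)
    ... | no none = contradiction (∈-++⁺ʳ (tabulate block) (∈-subsets⁺ A e e⊆A |e|)) e∉H
      where
      e⊆A : e ⊆ A
      e⊆A {v} v∈e with inA v Bool.≟ true
      ... | yes eq = ∈-tabulateᵇ⁺ inA eq
      ... | no neq = contradiction (v , v∈e , neq) none

-- Minimising over the admissible values

argmin : ∀ {P : ℕ → Set} (f : ℕ → ℕ) → (∀ b → Dec (P b)) → ∀ N {a₀} → P a₀ →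
         ∃ λ a → P a × f a ≤ f a₀ × (∀ b → b < N → P b → f a ≤ f b)
-- The given `a₀` is the default, so the search cannot come out empty.
argmin f P? zero {a₀} p = a₀ , p , ≤-refl , λ _ ()
argmin f P? (suc N) {a₀} p with argmin f P? N p
... | a , pa , le , min with P? N
...   | no ¬pN = a , pa , le , λ b b< pb → min b (≤∧≢⇒< (m<1+n⇒m≤n b<) λ { refl → ¬pN pb }) pb
...   | yes pN with f a ≤? f N
...     | yes h = a , pa , le , λ b b< pb → case-≤ b b< pb
  where
  case-≤ : ∀ b → b < suc N → _ → f a ≤ f b
  case-≤ b b< pb with b ≟ N
  ... | yes refl = h
  ... | no b≢N = min b (≤∧≢⇒< (m<1+n⇒m≤n b<) b≢N) pb
...     | no ¬h = N , pN , ≤-trans (<⇒≤ (≰⇒> ¬h)) le , case-≤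
  where
  case-≤ : ∀ b → b < suc N → _ → f N ≤ f b
  case-≤ b b< pb with b ≟ N
  ... | yes refl = ≤-refl
  ... | no b≢N = ≤-trans (<⇒≤ (≰⇒> ¬h)) (min b (≤∧≢⇒< (m<1+n⇒m≤n b<) b≢N) pb)

1≤nCk : ∀ n k → k ≤ n → 1 ≤ n C k
1≤nCk n zero _ = ≤-refl
1≤nCk (suc n) (suc k) (s≤s k≤n) = subst (1 ≤_) (nCk+nC[k+1]≡[n+1]C[k+1] n k) (≤-trans (1≤nCk n k k≤n) (m≤m+n _ _))

-- From `k` on, each further element adds `n C k`, at least 1, by Pascal's rule. Applied to `a ∸ 1`,
-- it bounds every admissible `a` independently of `n`.
n≤k+nCk : ∀ n k → n ≤ suc k + n C suc k
n≤k+nCk zero k = z≤n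
n≤k+nCk (suc n) k with k ≤? n
... | no k≰n = m≤n⇒m≤n+o _ (m≤n⇒m≤1+n (≰⇒> k≰n))
... | yes k≤n = begin
  suc n ≤⟨ s≤s (n≤k+nCk n k) ⟩
  1 + (suc k + n C suc k) ≤⟨ +-monoˡ-≤ (suc k + n C suc k) (1≤nCk n k k≤n) ⟩
  n C k + (suc k + n C suc k) ≡⟨ +-assoc (n C k) (suc k) _ ⟨
  n C k + suc k + n C suc k ≡⟨ cong (_+ n C suc k) (+-comm (n C k) (suc k)) ⟩
  suc k + n C k + n C suc k ≡⟨ +-assoc (suc k) (n C k) _ ⟩
  suc k + (n C k + n C suc k) ≡⟨ cong (suc k +_) (nCk+nC[k+1]≡[n+1]C[k+1] n k) ⟩
  suc k + suc n C suc k ∎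
  where open ≤-Reasoning

-- Passing from `b` up to `k` does not raise the ceiling, and `k C suc k` is 0. So values below `k`,
-- including 0, can be left out of the minimisation.
rhsTerm-≤ : ∀ k ℓ n {b} → b < k → rhsTerm (suc k) ℓ n k ≤ rhsTerm (suc k) ℓ n b
rhsTerm-≤ k ℓ n {b} b<k = +-mono-≤
  (/-monoˡ-≤ (suc k) (+-monoˡ-≤ k (*-monoʳ-≤ (ℓ ∸ 1) (∸-monoʳ-≤ n (<⇒≤ b<k)))))
  (≤-trans (≤-reflexive (k>n⇒nCk≡0 (n<1+n k))) z≤n)

theorem1p4 : (k ℓ : ℕ) → 3 ≤ k → 2 ≤ ℓ →
    Σ ℕ (λ N → (n : ℕ) → N ≤ n →
    Σ ℕ (λ s → IsSatNumber k n (star ℓ) s × IsMinRHS k ℓ n s))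
theorem1p4 (suc (suc k)) (suc (suc l)) (s≤s (s≤s 1≤k)) (s≤s (s≤s _)) = suc (M + B) , go
  where
  -- The uniformity is `suc K`. `B` bounds every admissible `a`, so `M + B < n` gives the
  -- construction the room it needs.
  K B M : ℕ
  K = suc k
  B = suc (K + l)
  M = reach (suc K) (suc l) * suc K

  go : ∀ n → suc (M + B) ≤ n →
       Σ ℕ λ s → IsSatNumber (suc K) n (star (suc (suc l))) s × IsMinRHS (suc K) (suc (suc l)) n s
  -- The search starts from `K`, which is admissible because `k C K` is 0.
  go n N≤n = result (argmin rhs P? (suc n) {K}
    ((s≤s z≤n , K≤n , ≤-trans (≤-reflexive (k>n⇒nCk≡0 (n<1+n k))) z≤n) , ≤-refl))
    where
    rhs : ℕ → ℕ
    rhs = rhsTerm (suc K) (suc (suc l)) n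

    -- The condition `K ≤ a` is the one under which the construction works.
    P : ℕ → Set
    P a = Admissible (suc K) (suc (suc l)) n a × K ≤ a

    P? : ∀ a → Dec (P a)
    P? a = (1 ≤? a ×-dec a ≤? n ×-dec (a ∸ 1) C K ≤? l) ×-dec K ≤? a

    B≤n : B ≤ n
    B≤n = ≤-trans (m≤n+m B (suc M)) N≤n

    K≤n : K ≤ n
    K≤n = ≤-trans (≤-trans (m≤m+n K l) (n≤1+n _)) B≤n

    result : (∃ λ a → P a × rhs a ≤ rhs K × (∀ b → b < suc n → P b → rhs a ≤ rhs b)) →
             Σ ℕ λ s → IsSatNumber (suc K) n (star (suc (suc l))) s × IsMinRHS (suc K) (suc (suc l)) n s
    result (a , (adm@(1≤a , a≤n , C≤l) , K≤a) , a≤K , min) =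
      rhs a , ((H , saturated , length-H) , lower) , (a , adm , refl) , λ b (p , q , r) → least b q λ _ → r
      where
      a≤B : a ≤ B
      a≤B = subst (_≤ B) (m+[n∸m]≡n 1≤a) (s≤s (≤-trans (n≤k+nCk (a ∸ 1) k) (+-monoʳ-≤ K C≤l)))

      open Construction K l n a (s≤s 1≤k) K≤a a≤n C≤l (≤-trans (s≤s (+-monoʳ-≤ M a≤B)) N≤n)

      -- Phrased to accept the witness of the lower bound, which may be 0; that value falls under
      -- `b < K`.
      least : ∀ b → b ≤ n → (1 ≤ b → (b ∸ 1) C K ≤ l) → rhs a ≤ rhs b
      least b b≤n h with K ≤? b
      ... | yes K≤b = min b (s≤s b≤n) ((≤-trans (s≤s z≤n) K≤b , b≤n , h (≤-trans (s≤s z≤n) K≤b)) , K≤b)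
      ... | no K≰b = ≤-trans a≤K (rhsTerm-≤ K (suc (suc l)) n (≰⇒> K≰b))

      lower : ∀ H′ → IsBergeSaturated (suc K) (star (suc (suc l))) H′ → rhs a ≤ length H′
      lower H′ sat with saturated-lower-bound sat
      ... | b , b≤n , h , le = ≤-trans (least b b≤n h) le
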